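{- (ZFC) There are no Magidor filters; that is, for no uncountable cardinal $\lambda$ is there a Magidor filter over $\lambda$.
   Context: The ambient theory is ZFC. For a cardinal $\lambda$ and $x\subseteq\lambda$, $[x]^{\aleph_0\text{ -bd}}$ denotes the collection of all subsets $u\subseteq x$ with $|u|=\aleph_0$ and $u$ bounded in $\lambda$, i.e. $\sup(u)<\lambda$ (there is no restriction on the order type of $u$). For $c:[\lambda]^{\aleph_0\text{ -bd}}\rightarrow\lambda$, $c''[x]^{\aleph_0\text{ -bd}}=\{c(u):u\in[x]^{\aleph_0\text{ -bd}}\}$. A filter $F$ over $\lambda$ (a filter of subsets of $\lambda$) is uniform iff every element of $F$ has cardinality $\lambda$. A filter $F$ over $\lambda$ is a Magidor filter iff: (1) $F$ is uniform; (2) $F$ contains all the end-segments $\{\beta<\lambda:\beta\geq\alpha\}$ of $\lambda$, for $\alpha<\lambda$; (3) for every coloring $c:[\lambda]^{\aleph_0\text{ -bd}}\rightarrow\lambda$ there exists $x\in F$ for which $c''[x]^{\aleph_0\text{ -bd}}\neq\lambda$. -}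

module Defs where

open import Level using (Level; suc; _⊔_)
open import Data.Nat.Base using (ℕ)
open import Data.Product.Base using (Σ; ∃; _×_; _,_; proj₁)
open import Function.Bundles using (Func; Bijection; _↣_)
open import Induction.WellFounded using (WellFounded)
open import Relation.Binary.Bundles using (Setoid)
open import Relation.Binary.Core using (Rel)
open import Relation.Binary.Structures using (IsStrictTotalOrder)
open import Relation.Binary.PropositionalEquality using (_≡_; setoid)
open import Relation.Nullary.Negation.Core using (¬_)
open import Relation.Unary using (Pred; _⊆_; _≐_; _∩_)
open import Relation.Unary.Polymorphic using (∅; U)
open import Relation.Unary.Relation.Binary.Equality using (≐-setoid)
import Relation.Binary.Construct.On as On
import Relation.Binary.Construct.StrictToNonStrict as NonStrict

-- The axiom of choice in its extensional form.  Requiring the choice function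
-- to respect the equality of S is what makes this the set-theoretic axiom;
-- the version without setoids is a theorem of type theory.
Choice : ∀ a e b r → Set (suc (a ⊔ e ⊔ b ⊔ r))
Choice a e b r =
  (S : Setoid a e) (B : Set b) → let open Setoid S in
  (R : Carrier → B → Set r) →
  (∀ {x x′ y} → x ≈ x′ → R x y → R x′ y) →
  (∀ x → ∃ λ y → R x y) →
  Σ (Func S (setoid B)) λ f → ∀ x → R x (Func.to f x)

-- A subset x of A seen as a set of its own.  Elements are compared in A, so
-- that different proofs of membership do not count as different elements.
⟦_⟧ : ∀ {a ℓ} {A : Set a} → Pred A ℓ → Setoid (a ⊔ ℓ) a
⟦_⟧ {A = A} x = On.setoid (setoid A) (proj₁ {B = x})

-- Equality of cardinality.
_≈ᶜ_ : ∀ {a ℓ₁ b ℓ₂} → Setoid a ℓ₁ → Setoid b ℓ₂ → Set (a ⊔ ℓ₁ ⊔ b ⊔ ℓ₂)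
S ≈ᶜ T = Bijection S T

-- A cardinal is an initial ordinal: a well-order that is not equinumerous with
-- any of its proper initial segments.  The elements of the carrier play the
-- role of the ordinals below it.
record Cardinal (ℓ : Level) : Set (suc ℓ) where
  infix 4 _<_
  field
    Carrier            : Set ℓ
    _<_                : Rel Carrier ℓ
    isStrictTotalOrder : IsStrictTotalOrder _≡_ _<_
    wellFounded        : WellFounded _<_
    initial            : ∀ α → ¬ (⟦ (λ β → β < α) ⟧ ≈ᶜ setoid Carrier)

  open NonStrict _≡_ _<_ public using (_≤_)

Uncountable : ∀ {ℓ} → Cardinal ℓ → Set ℓ
Uncountable lam = ¬ (Cardinal.Carrier lam ↣ ℕ)

module _ {ℓ} (lam : Cardinal ℓ) where
  open Cardinal lam

  Subset : Set (suc ℓ)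
  Subset = Pred Carrier ℓ

  Denumerable : Subset → Set ℓ
  Denumerable u = setoid ℕ ≈ᶜ ⟦ u ⟧

  -- sup u < lam; as sup u is the least upper bound of u, this says that u has
  -- an upper bound below lam.
  Bounded : Subset → Set ℓ
  Bounded u = ∃ λ α → ∀ {β} → u β → β ≤ α

  -- [lam]^(ℵ₀-bd), with extensional equality of subsets: a colouring may
  -- depend neither on how a subset is presented nor on the proofs of
  -- denumerability and boundedness.
  [-]^ℵ₀-bd : Setoid (suc ℓ) ℓ
  [-]^ℵ₀-bd = On.setoid (≐-setoid Carrier ℓ)
                (proj₁ {B = λ u → Denumerable u × Bounded u})

  Coloring : Set (suc ℓ)
  Coloring = Func [-]^ℵ₀-bd (setoid Carrier)

  -- c″[x]^(ℵ₀-bd)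
  image : Coloring → Subset → Pred Carrier (suc ℓ)
  image c x γ = ∃ λ u → proj₁ u ⊆ x × Func.to c u ≡ γ

  record IsFilter {f} (F : Pred Subset f) : Set (suc ℓ ⊔ f) where
    field
      whole        : F U
      proper       : ¬ F ∅
      upward       : ∀ {x y} → F x → x ⊆ y → F y
      intersection : ∀ {x y} → F x → F y → F (x ∩ y)

  record IsMagidorFilter {f} (F : Pred Subset f) : Set (suc ℓ ⊔ f) where
    field
      isFilter    : IsFilter F
      uniform     : ∀ {x} → F x → ⟦ x ⟧ ≈ᶜ setoid Carrier
      endSegments : ∀ α → F (λ β → α ≤ β)
      magidor     : ∀ (c : Coloring) → ∃ λ x → F x × ¬ (image c x ≐ U {ℓ = suc ℓ})

{-# OPTIONS --safe #-}
module Submission where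

-- Let κ be least such that no colouring sends [x]^(ℵ₀-bd) onto κ for every x in
-- F.  Such colourings compose, so κ is also beyond the reach of an unbounded
-- union of smaller ordinals: every function λ → κ is bounded on some x in F.
-- Following Galvin and Prikry, choose a representative of every ω-sequence
-- modulo equality of tails, and let "before" send a tail of a representative
-- to the entry preceding it.
--
-- By recursion on ξ < κ choose y ξ in F that, for every finite s ⊆ ξ, misses
-- some point of T = ⋂ {y η : η ∈ s} ∩ K m, and omits it as a value of
-- "before" as well, whenever T maps onto κ.  Here λ = ⋃ K m, and increasing
-- ω-sequences in a single K m are bounded.  By boundedness, there are ε < κ and
-- x in F such that for every β in x either {ξ : β ∈ y ξ} is contained in ε,
-- which intersecting x with y ε excludes, or it has infinitely many elements
-- that are at most ε.  Splitting x according to these elements, one after the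
-- other, gives ξ 0 < ξ 1 < … such that each ⋂ {y (ξ i) : i < n} ∩ K m
-- maps onto κ.  So there are a n in y (ξ i) for i < n that are neither in
-- y (ξ n) nor values of "before" there; but "before" applied to a tail of
-- (an increasing subsequence of) a yields the preceding entry.

open import Defs
open import Axiom.DoubleNegationElimination using (em⇒dne)
open import Axiom.ExcludedMiddle using (ExcludedMiddle)
open import Data.Empty using (⊥)
open import Data.List.Base using (List; []; _∷_; length; applyUpTo)
open import Data.List.Relation.Unary.All as All using (All; []; _∷_)
open import Data.List.Relation.Unary.All.Properties using (applyUpTo⁺₁; applyUpTo⁻)
open import Data.List.Relation.Unary.Any using (Any; here; there)
open import Data.Nat.Base as ℕ using (ℕ; zero; suc; _+_; _∸_; pred)
import Data.Nat.Properties as ℕ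
open import Data.Product.Base using (Σ; ∃; _×_; _,_; proj₁; proj₂)
open import Data.Sum.Base as Sum using (_⊎_; inj₁; inj₂; [_,_]′)
open import Data.Unit.Polymorphic.Base using (tt)
open import Function.Base using (_∘_; id; const; case_of_)
open import Function.Bundles using (Func; Bijection; mk↣)
open import Induction.WellFounded using (WellFounded; WfRec; module All; module FixPoint)
open import Level using (_⊔_) renaming (suc to lsuc)
open import Relation.Binary.Bundles using (Setoid)
open import Relation.Binary.Core using (Rel)
open import Relation.Binary.Definitions using (tri<; tri≈; tri>)
open import Relation.Binary.PropositionalEquality
  using (_≡_; _≢_; _≗_; refl; sym; trans; cong; cong₂; subst; subst₂; setoid; _→-setoid_; module ≡-Reasoning)
open import Relation.Binary.Structures using (IsStrictTotalOrder)
open import Relation.Nullary.Decidable.Core using (yes; no)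
open import Relation.Nullary.Negation.Core using (¬_; contradiction)
open import Relation.Unary using (Pred; _⊆_; _≐_; _∩_)
open import Relation.Unary.Polymorphic using (U)
import Relation.Binary.Construct.StrictToNonStrict as NonStrict

-- Classical logic and well-orders

module Classical (em : ∀ {p} → ExcludedMiddle p) where

  dne : ∀ {p} {P : Set p} → ¬ ¬ P → P
  dne = em⇒dne em

  ¬∀⇒∃¬ : ∀ {a p} {A : Set a} {P : A → Set p} → ¬ (∀ x → P x) → ∃ λ x → ¬ P x
  ¬∀⇒∃¬ ¬∀ = dne λ ¬∃ → ¬∀ λ x → dne λ ¬Px → ¬∃ (x , ¬Px)

module _ {a} {A : Set a} where

  -- The arguments trade places at every step, so the lemmas below recurse on `h` and `g ∘ suc`,
  -- exchanging left and right.
  interleave : (ℕ → A) → (ℕ → A) → ℕ → A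
  interleave g h zero    = g 0
  interleave g h (suc n) = interleave h (g ∘ suc) n

  interleave-hitsˡ : ∀ g h j → ∃ λ n → interleave g h n ≡ g j
  interleave-hitsʳ : ∀ g h j → ∃ λ n → interleave g h n ≡ h j

  interleave-hitsˡ g h zero    = 0 , refl
  interleave-hitsˡ g h (suc j) with interleave-hitsʳ h (g ∘ suc) j
  ... | n , eq = suc n , eq

  interleave-hitsʳ g h j with interleave-hitsˡ h (g ∘ suc) j
  ... | n , eq = suc n , eq

  interleave-∈ : ∀ g h n → (∃ λ j → interleave g h n ≡ g j) ⊎ (∃ λ j → interleave g h n ≡ h j)
  interleave-∈ g h zero    = inj₁ (0 , refl)
  interleave-∈ g h (suc n) with interleave-∈ h (g ∘ suc) n
  ... | inj₁ hit      = inj₂ hit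
  ... | inj₂ (j , eq) = inj₁ (suc j , eq)

  private
    Inj : (ℕ → A) → Set a
    Inj g = ∀ {m n} → g m ≡ g n → m ≡ n

  interleave-injective : ∀ g h → Inj g → Inj h → (∀ m n → g m ≢ h n) → Inj (interleave g h)
  interleave-injective g h gi hi g≢h = inj _ _
    where
    head≢ : ∀ n → g 0 ≢ interleave h (g ∘ suc) n
    head≢ n eq with interleave-∈ h (g ∘ suc) n
    ... | inj₁ (j , eq′) = g≢h 0 j (trans eq eq′)
    ... | inj₂ (j , eq′) = contradiction (gi (trans eq eq′)) λ ()

    inj : ∀ m n → interleave g h m ≡ interleave g h n → m ≡ n
    inj zero    zero    eq = refl
    inj zero    (suc n) eq = contradiction eq (head≢ n)
    inj (suc m) zero    eq = contradiction (sym eq) (head≢ m)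
    inj (suc m) (suc n) eq = cong suc (interleave-injective h (g ∘ suc) hi (ℕ.suc-injective ∘ gi)
      (λ i j → g≢h (suc j) i ∘ sym) eq)

module WellOrder
  (em : ∀ {p} → ExcludedMiddle p) (choice : ∀ {a e b r} → Choice a e b r)
  {ℓ} {C : Set ℓ} {_<_ : Rel C ℓ}
  (sto : IsStrictTotalOrder _≡_ _<_) (wf : WellFounded _<_)
  where

  open Classical em
  open NonStrict _≡_ _<_ public using (_≤_)
  open IsStrictTotalOrder sto public using (compare) renaming (trans to <-trans; irrefl to <-irrefl)

  <-≤-trans : ∀ {x y z} → x < y → y ≤ z → x < z
  <-≤-trans x<y (inj₁ y<z)  = <-trans x<y y<z
  <-≤-trans x<y (inj₂ refl) = x<y

  ≤-<-trans : ∀ {x y z} → x ≤ y → y < z → x < z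
  ≤-<-trans (inj₁ x<y)  y<z = <-trans x<y y<z
  ≤-<-trans (inj₂ refl) y<z = y<z

  ≤-trans : ∀ {x y z} → x ≤ y → y ≤ z → x ≤ z
  ≤-trans x≤y (inj₁ y<z)  = inj₁ (≤-<-trans x≤y y<z)
  ≤-trans x≤y (inj₂ refl) = x≤y

  <⇒≱ : ∀ {x y} → x < y → ¬ (y ≤ x)
  <⇒≱ x<y y≤x = <-irrefl refl (<-≤-trans x<y y≤x)

  ≮⇒≥ : ∀ {x y} → ¬ (x < y) → y ≤ x
  ≮⇒≥ {x} {y} x≮y with compare x y
  ... | tri< x<y _ _  = contradiction x<y x≮y
  ... | tri≈ _ refl _ = inj₂ refl
  ... | tri> _ _ y<x  = inj₁ y<x

  ≤-antisym : ∀ {x y} → x ≤ y → y ≤ x → x ≡ y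
  ≤-antisym (inj₁ x<y) y≤x = contradiction y≤x (<⇒≱ x<y)
  ≤-antisym (inj₂ eq)  _   = eq

  ≤∧≢⇒< : ∀ {x y} → x ≤ y → x ≢ y → x < y
  ≤∧≢⇒< (inj₁ x<y) _   = x<y
  ≤∧≢⇒< (inj₂ eq)  x≢y = contradiction eq x≢y

  upper-bound : ∀ x y → ∃ λ z → x ≤ z × y ≤ z
  upper-bound x y with compare x y
  ... | tri< x<y _ _  = y , inj₁ x<y , inj₂ refl
  ... | tri≈ _ refl _ = y , inj₂ refl , inj₂ refl
  ... | tri> _ _ y<x  = x , inj₂ refl , inj₁ y<x

  least : ∀ {p} {P : Pred C p} → ∃ P → ∃ λ x → P x × (∀ {y} → P y → x ≤ y)
  least {p} {P} (x , Px) = All.wfRec wf _ (λ x → P x → Result) step x Px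
    where
    Result : Set _
    Result = ∃ λ x → P x × (∀ {y} → P y → x ≤ y)

    step : ∀ x → (∀ {y} → y < x → P y → Result) → P x → Result
    step x rec Px with em {P = ∃ λ y → y < x × P y}
    ... | yes (y , y<x , Py) = rec y<x Py
    ... | no ¬∃ = x , Px , λ {y} Py → ≮⇒≥ λ y<x → ¬∃ (y , y<x , Py)

  -- Extensionality of the choice is what makes the value at ξ depend only on
  -- the values below ξ, and not on the proofs of accessibility.
  recursive-choice : ∀ {b r} {B : Set b} (Q : ∀ ξ → (∀ η → η < ξ → B) → B → Set r) →
    (∀ {ξ h h′ y} → (∀ η η<ξ → h η η<ξ ≡ h′ η η<ξ) → Q ξ h y → Q ξ h′ y) →
    (∀ ξ h → ∃ (Q ξ h)) →
    ∃ λ (y : C → B) → ∀ ξ → Q ξ (λ η _ → y η) (y ξ)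
  recursive-choice {b} {r} {B} Q resp total = y , λ ξ →
    subst (Q ξ _) (sym (FixPoint.unfold-wfRec wf (const B) step step-ext)) (proj₂ (pick ξ) _)
    where
    S : C → Setoid _ _
    S ξ = record
      { Carrier       = ∀ η → η < ξ → B
      ; _≈_           = λ h h′ → ∀ η η<ξ → h η η<ξ ≡ h′ η η<ξ
      ; isEquivalence = record
        { refl  = λ _ _ → refl
        ; sym   = λ eq η η<ξ → sym (eq η η<ξ)
        ; trans = λ eq eq′ η η<ξ → trans (eq η η<ξ) (eq′ η η<ξ)
        }
      }

    pick : ∀ ξ → Σ (Func (S ξ) (setoid B)) λ F → ∀ h → Q ξ h (Func.to F h)
    pick ξ = choice (S ξ) B (Q ξ) resp (total ξ)

    step : ∀ ξ → WfRec _<_ (const B) ξ → B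
    step ξ rec = Func.to (proj₁ (pick ξ)) λ _ → rec

    step-ext : ∀ ξ {h h′ : WfRec _<_ (const B) ξ} →
               (∀ {η} η<ξ → h {η} η<ξ ≡ h′ η<ξ) → step ξ h ≡ step ξ h′
    step-ext ξ eq = Func.cong (proj₁ (pick ξ)) λ _ → eq

    y : C → B
    y = All.wfRec wf _ (const B) step

  Increasing : (ℕ → C) → Set ℓ
  Increasing b = ∀ n → b n < b (suc n)

  module _ {b : ℕ → C} (inc : Increasing b) where

    Increasing-+ : ∀ m n → b m < b (suc m + n)
    Increasing-+ m zero    = subst (λ k → b m < b (suc k)) (sym (ℕ.+-identityʳ m)) (inc m)
    Increasing-+ m (suc n) = <-trans (Increasing-+ m n)
      (subst (λ k → b (suc m + n) < b (suc k)) (sym (ℕ.+-suc m n)) (inc (suc m + n)))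

    Increasing-< : ∀ {m n} → m ℕ.< n → b m < b n
    Increasing-< {m} m<n with ℕ.m≤n⇒∃[o]m+o≡n m<n
    ... | k , refl = Increasing-+ m k

    Increasing-≤ : ∀ {m n} → m ℕ.≤ n → b m ≤ b n
    Increasing-≤ m≤n with ℕ.m≤n⇒m<n∨m≡n m≤n
    ... | inj₁ m<n  = inj₁ (Increasing-< m<n)
    ... | inj₂ refl = inj₂ refl

    Increasing-injective : ∀ {m n} → b m ≡ b n → m ≡ n
    Increasing-injective {m} {n} eq with ℕ.<-cmp m n
    ... | tri< m<n _ _ = contradiction (Increasing-< m<n) (<-irrefl eq)
    ... | tri≈ _ m≡n _ = m≡n
    ... | tri> _ _ n<m = contradiction (Increasing-< n<m) (<-irrefl (sym eq))

    Increasing-drop : ∀ m → Increasing (λ n → b (m + n))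
    Increasing-drop m n = subst (λ k → b (m + n) < b k) (sym (ℕ.+-suc m n)) (inc (m + n))

  -- Repeatedly pick an index of a least value among the indices after the last one picked. The
  -- values never decrease, and distinctness makes them increase strictly.
  increasing-subsequence : (a : ℕ → C) → (∀ {m n} → m ℕ.< n → a m ≢ a n) →
    ∃ λ (ν : ℕ → ℕ) → (∀ {m n} → m ℕ.< n → ν m ℕ.< ν n) × Increasing (a ∘ ν)
  increasing-subsequence a distinct = ν , ν-mono , λ n →
    ≤∧≢⇒< (min n _ (ℕ.≤-trans (start≤ n) (ℕ.<⇒≤ (ν-suc n)))) (distinct (ν-suc n))
    where
    argmin : ∀ N → ∃ λ n → N ℕ.≤ n × (∀ j → N ℕ.≤ j → a n ≤ a j)
    argmin N with least {P = λ z → ∃ λ n → N ℕ.≤ n × a n ≡ z} (a N , N , ℕ.≤-refl , refl)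
    ... | _ , (n , N≤n , refl) , min = n , N≤n , λ j N≤j → min (j , N≤j , refl)

    start ν : ℕ → ℕ
    ν n = proj₁ (argmin (start n))
    start zero    = 0
    start (suc n) = suc (ν n)

    start≤ : ∀ n → start n ℕ.≤ ν n
    start≤ n = proj₁ (proj₂ (argmin (start n)))

    min : ∀ n j → start n ℕ.≤ j → a (ν n) ≤ a j
    min n = proj₂ (proj₂ (argmin (start n)))

    ν-suc : ∀ n → ν n ℕ.< ν (suc n)
    ν-suc n = start≤ (suc n)

    ν-+ : ∀ m k → ν m ℕ.< ν (suc m + k)
    ν-+ m zero    = subst (λ k → ν m ℕ.< ν (suc k)) (sym (ℕ.+-identityʳ m)) (ν-suc m)
    ν-+ m (suc k) = ℕ.<-trans (ν-+ m k)
      (subst (λ i → ν (suc m + k) ℕ.< ν (suc i)) (sym (ℕ.+-suc m k)) (ν-suc (suc m + k)))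

    ν-mono : ∀ {m n} → m ℕ.< n → ν m ℕ.< ν n
    ν-mono {m} m<n with ℕ.m≤n⇒∃[o]m+o≡n m<n
    ... | k , refl = ν-+ m k

  -- Galvin and Prikry: rep chooses a representative of every class of
  -- sequences modulo equality of tails, pos locates a sequence that is a tail
  -- of its representative, and before is the entry preceding that tail.
  _∼_ : Rel (ℕ → C) ℓ
  b ∼ b′ = ∃ λ i → ∃ λ j → ∀ k → b (i + k) ≡ b′ (j + k)

  tail-setoid : Setoid ℓ ℓ
  tail-setoid = record
    { Carrier       = ℕ → C
    ; _≈_           = _∼_
    ; isEquivalence = record
      { refl  = 0 , 0 , λ _ → refl
      ; sym   = λ (i , j , eq) → j , i , λ k → sym (eq k)
      ; trans = λ {b} {b′} {b″} (i , j , eq) (i′ , j′ , eq′) →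
          i + i′ , j′ + j , λ k → begin
            b (i + i′ + k)     ≡⟨ cong b (ℕ.+-assoc i i′ k) ⟩
            b (i + (i′ + k))   ≡⟨ eq (i′ + k) ⟩
            b′ (j + (i′ + k))  ≡⟨ cong b′ (ℕ.+-assoc j i′ k) ⟨
            b′ (j + i′ + k)    ≡⟨ cong (λ l → b′ (l + k)) (ℕ.+-comm j i′) ⟩
            b′ (i′ + j + k)    ≡⟨ cong b′ (ℕ.+-assoc i′ j k) ⟩
            b′ (i′ + (j + k))  ≡⟨ eq′ (j + k) ⟩
            b″ (j′ + (j + k))  ≡⟨ cong b″ (ℕ.+-assoc j′ j k) ⟨
            b″ (j′ + j + k)    ∎
      }
    }
    where open ≡-Reasoning

  private
    module ∼ = Setoid tail-setoid

    reps = choice tail-setoid (ℕ → C) _∼_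
      (λ {b} {b′} {s} b∼b′ b∼s → ∼.trans {b′} {b} {s} (∼.sym {b} {b′} b∼b′) b∼s)
      (λ b → b , ∼.refl {b})

  rep : (ℕ → C) → ℕ → C
  rep = Func.to (proj₁ reps)

  rep-cong : ∀ {b b′} → b ∼ b′ → rep b ≡ rep b′
  rep-cong = Func.cong (proj₁ reps)

  rep-∼ : ∀ b → b ∼ rep b
  rep-∼ = proj₂ reps

  ≗⇒∼ : ∀ {b b′} → b ≗ b′ → b ∼ b′
  ≗⇒∼ eq = 0 , 0 , eq

  private
    TailAt : (ℕ → C) → ℕ → Set ℓ
    TailAt b k = ∀ n → b n ≡ rep b (k + n)

    TailAt-resp : ∀ {b b′ k} → b ≗ b′ → TailAt b k → TailAt b′ k
    TailAt-resp {k = k} eq at n =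
      trans (sym (eq n)) (trans (at n) (cong (λ s → s (k + n)) (rep-cong (≗⇒∼ eq))))

    -- The relation is conditional, hence total: a sequence that is no tail of its representative
    -- gets position 0.
    positions = choice (ℕ →-setoid C) ℕ (λ b k → ∃ (TailAt b) → TailAt b k)
      (λ eq at → TailAt-resp eq ∘ at ∘ λ (k , at′) → k , TailAt-resp (sym ∘ eq) at′)
      total
      where
      total : ∀ b → ∃ λ k → ∃ (TailAt b) → TailAt b k
      total b with em {P = ∃ (TailAt b)}
      ... | yes (k , at) = k , λ _ → at
      ... | no ¬at       = 0 , λ at → contradiction at ¬at

  pos : (ℕ → C) → ℕ
  pos = Func.to (proj₁ positions)

  pos-cong : ∀ {b b′} → b ≗ b′ → pos b ≡ pos b′
  pos-cong = Func.cong (proj₁ positions)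

  before : (ℕ → C) → C
  before b = rep b (pred (pos b))

  before-cong : ∀ {b b′} → b ≗ b′ → before b ≡ before b′
  before-cong eq = cong₂ (λ s k → s (pred k)) (rep-cong (≗⇒∼ eq)) (pos-cong eq)

  module _ {b : ℕ → C} (inc : Increasing b) where

    private
      -- Positions `k < l` would make `b 0` equal to the later entry at index `l ∸ k`.
      ≮ : ∀ {k l} → TailAt b k → TailAt b l → ¬ (k ℕ.< l)
      ≮ {k} at at′ k<l with ℕ.m≤n⇒∃[o]m+o≡n k<l
      ... | d , refl = contradiction (Increasing-injective inc {0} {suc d} eq) λ ()
        where
        eq : b 0 ≡ b (suc d)
        eq = begin
          b 0                  ≡⟨ at′ 0 ⟩
          rep b (suc k + d + 0) ≡⟨ cong (rep b) (trans (ℕ.+-identityʳ _) (sym (ℕ.+-suc k d))) ⟩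
          rep b (k + suc d)    ≡⟨ at (suc d) ⟨
          b (suc d)            ∎
          where open ≡-Reasoning

    pos-unique : ∀ {k} → TailAt b k → pos b ≡ k
    pos-unique {k} at with ℕ.<-cmp (pos b) k
    ... | tri< lt _ _ = contradiction lt (≮ (proj₂ positions b (k , at)) at)
    ... | tri≈ _ eq _ = eq
    ... | tri> _ _ gt = contradiction gt (≮ at (proj₂ positions b (k , at)))

  module _ {b : ℕ → C} (inc : Increasing b) where

    private
      i = proj₁ (rep-∼ b)
      j = proj₁ (proj₂ (rep-∼ b))

      drop-at : ∀ k n → b (i + k + n) ≡ rep b (j + k + n)
      drop-at k n = begin
        b (i + k + n)       ≡⟨ cong b (ℕ.+-assoc i k n) ⟩
        b (i + (k + n))     ≡⟨ proj₂ (proj₂ (rep-∼ b)) (k + n) ⟩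
        rep b (j + (k + n)) ≡⟨ cong (rep b) (ℕ.+-assoc j k n) ⟨
        rep b (j + k + n)   ∎
        where open ≡-Reasoning

      rep-drop : ∀ k → rep b ≡ rep (λ n → b (i + k + n))
      rep-drop k = rep-cong (i + k , 0 , λ _ → refl)

    -- All tails of `b` share one representative; once `b` agrees with it, the position counts the
    -- dropped entries.
    pos-drop : ∃ λ i → ∃ λ j → ∀ k → pos (λ n → b (i + k + n)) ≡ j + k
    pos-drop = i , j , λ k → pos-unique (Increasing-drop inc (i + k))
      λ n → trans (drop-at k n) (cong (λ s → s (j + k + n)) (rep-drop k))

    -- One entry past the start of the agreement, the position is the successor `j + 1`, so `pred`
    -- gives `j`, where the representative has the entry `b i`.
    before-drop : ∃ λ n → before (λ k → b (suc n + k)) ≡ b n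
    before-drop = i , (begin
      before (λ k → b (suc i + k))   ≡⟨ before-cong (λ k → cong (λ l → b (l + k)) (sym i+1)) ⟩
      before (λ k → b (i + 1 + k))   ≡⟨ cong₂ (λ s k → s (pred k)) (sym (rep-drop 1)) (proj₂ (proj₂ pos-drop) 1) ⟩
      rep b (pred (j + 1))           ≡⟨ cong (rep b ∘ pred) (ℕ.+-comm j 1) ⟩
      rep b j                        ≡⟨ cong (rep b) (trans (ℕ.+-identityʳ _) (ℕ.+-identityʳ _)) ⟨
      rep b (j + 0 + 0)              ≡⟨ drop-at 0 0 ⟨
      b (i + 0 + 0)                  ≡⟨ cong b (trans (ℕ.+-identityʳ _) (ℕ.+-identityʳ _)) ⟩
      b i                            ∎)
      where
      open ≡-Reasoning
      i+1 : i + 1 ≡ suc i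
      i+1 = ℕ.+-comm i 1

-- Colourings read along a Magidor filter

module MagidorFilter
  (em : ∀ {p} → ExcludedMiddle p) (choice : ∀ {a e b r} → Choice a e b r)
  {ℓ f} (lam : Cardinal ℓ) (uncountable : Uncountable lam)
  (F : Pred (Subset lam) f) (isMagidor : IsMagidorFilter lam F)
  where

  open Cardinal lam using (_<_) renaming (Carrier to C)
  open Classical em
  open WellOrder em choice (Cardinal.isStrictTotalOrder lam) (Cardinal.wellFounded lam)
  open IsMagidorFilter isMagidor
  open IsFilter isFilter

  Sub : Set (lsuc ℓ)
  Sub = Pred C ℓ

  inhabited : ∀ {y} → F y → ∃ y
  inhabited {y} Fy = dne λ ¬∃ → proper (upward Fy λ {β} yβ → contradiction (β , yβ) ¬∃)

  tail : Sub → C → Sub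
  tail y δ = y ∩ (δ ≤_)

  F-tail : ∀ {y} → F y → ∀ δ → F (tail y δ)
  F-tail Fy δ = intersection Fy (endSegments δ)

  -- By uniformity `y` maps onto the whole cardinal; sending each point to an index of a preimage
  -- would inject it into ℕ.
  ¬enumerable : ∀ {y} → F y → ¬ (∃ λ (g : ℕ → C) → ∀ {β} → y β → ∃ λ k → β ≡ g k)
  ¬enumerable {y} Fy (g , enum) = uncountable (mk↣ {to = index} injective)
    where
    open Bijection (uniform Fy) using (to; strictlySurjective) renaming (cong to to-cong)

    from : C → Σ C y
    from = proj₁ ∘ strictlySurjective

    index : C → ℕ
    index = proj₁ ∘ enum ∘ proj₂ ∘ from

    injective : ∀ {c d} → index c ≡ index d → c ≡ d
    injective {c} {d} eq = begin
      c             ≡⟨ proj₂ (strictlySurjective c) ⟨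
      to (from c)   ≡⟨ to-cong same ⟩
      to (from d)   ≡⟨ proj₂ (strictlySurjective d) ⟩
      d             ∎
      where
      open ≡-Reasoning
      same : proj₁ (from c) ≡ proj₁ (from d)
      same = begin
        proj₁ (from c)  ≡⟨ proj₂ (enum (proj₂ (from c))) ⟩
        g (index c)     ≡⟨ cong g eq ⟩
        g (index d)     ≡⟨ proj₂ (enum (proj₂ (from d))) ⟨
        proj₁ (from d)  ∎

  F-unbounded : ∀ {y} → F y → ∀ δ → ∃ λ β → y β × δ < β
  F-unbounded {y} Fy δ = dne λ ¬∃ → ¬enumerable (F-tail Fy δ)
    (const δ , λ (yβ , δ≤β) → 0 , ≤-antisym (≮⇒≥ λ δ<β → ¬∃ (_ , yβ , δ<β)) δ≤β)

  -- The bound is kept as data because the next block has to start at or beyond it.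
  record Block (y : Sub) (δ : C) (b : ℕ → C) : Set ℓ where
    field
      inside     : ∀ n → y (b n)
      above      : δ ≤ b 0
      increasing : Increasing b
      bound      : C
      bounded    : ∀ n → b n < bound

    all-above : ∀ n → δ ≤ b n
    all-above n = ≤-trans above (Increasing-≤ increasing ℕ.z≤n)

  open Block using (bound)

  forget : ∀ {y δ b} → Block y δ b → Block U δ b
  forget B = record
    { inside     = λ _ → tt
    ; above      = Block.above B
    ; increasing = Block.increasing B
    ; bound      = bound B
    ; bounded    = Block.bounded B
    }

  Block-drop : ∀ {y δ b} → Block y δ b → ∀ m → Block y δ (λ n → b (m + n))
  Block-drop B m = record
    { inside     = λ n → inside (m + n)
    ; above      = all-above (m + 0)
    ; increasing = Increasing-drop increasing m
    ; bound      = bound B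
    ; bounded    = λ n → bounded (m + n)
    }
    where open Block B hiding (bound)

  -- Enumerate y increasingly from β on; if this were unbounded, it would
  -- exhaust a tail of y.
  block-from : ∀ {y} → F y → ∀ {β δ} → y β → δ ≤ β → ∃ λ b → Block y δ b × b 0 ≡ β
  block-from {y} Fy {β} {δ} yβ δ≤β = b , record
    { inside     = inside
    ; above      = δ≤β
    ; increasing = inc
    ; bound      = proj₁ bounded
    ; bounded    = proj₂ bounded
    } , refl
    where
    next : ∀ γ → ∃ λ z → (y z × γ < z) × (∀ {z′} → y z′ × γ < z′ → z ≤ z′)
    next γ = least (F-unbounded Fy γ)

    b : ℕ → C
    b zero    = β
    b (suc n) = proj₁ (next (b n))

    inside : ∀ n → y (b n)
    inside zero    = yβ
    inside (suc n) = proj₁ (proj₁ (proj₂ (next (b n))))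

    inc : Increasing b
    inc n = proj₂ (proj₁ (proj₂ (next (b n))))

    exhaust : ∀ n {z} → y z → β ≤ z → z ≤ b n → ∃ λ k → z ≡ b k
    exhaust zero    yz β≤z z≤b = 0 , ≤-antisym z≤b β≤z
    exhaust (suc n) {z} yz β≤z z≤b with em {P = b n < z}
    ... | yes b<z = suc n , ≤-antisym z≤b (proj₂ (proj₂ (next (b n))) (yz , b<z))
    ... | no  b≮z = exhaust n yz β≤z (≮⇒≥ b≮z)

    bounded : ∃ λ γ → ∀ n → b n < γ
    bounded = dne λ unbounded → ¬enumerable (F-tail Fy β) (b , λ {z} (yz , β≤z) →
      let n , b≮z = ¬∀⇒∃¬ λ b<z → unbounded (z , b<z) in exhaust n yz β≤z (≮⇒≥ b≮z))

  block-above : ∀ {y} → F y → ∀ δ γ → ∃ λ b → Block y δ b × γ < b 0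
  block-above Fy δ γ =
    let ε , δ≤ε , γ≤ε   = upper-bound δ γ
        β , yβ , ε<β    = F-unbounded Fy ε
        b , B , b0≡β    = block-from Fy yβ (inj₁ (≤-<-trans δ≤ε ε<β))
    in b , B , subst (γ <_) (sym b0≡β) (≤-<-trans γ≤ε ε<β)

  -- Codes, and the colourings they define

  Clue : Set ℓ
  Clue = C × C × ℕ

  -- The first entry reaches the points of a set, the second component is the Galvin-Prikry value,
  -- and the position serves to encode natural numbers.
  clue : (ℕ → C) → Clue
  clue b = b 0 , before b , pos b

  clue-cong : ∀ {b b′} → b ≗ b′ → clue b ≡ clue b′
  clue-cong eq = cong₂ _,_ (eq 0) (cong₂ _,_ (before-cong eq) (pos-cong eq))

  -- A colouring of the sets of order type ω · n that examines the successive
  -- blocks of order type ω and decides by itself when to stop; composing two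
  -- codes therefore needs no delimiter between their arguments.
  data Code {x} (X : Set x) : Set (ℓ ⊔ x) where
    return : X → Code X
    read   : (Clue → Code X) → Code X

  _>>=_ : ∀ {x y} {X : Set x} {Y : Set y} → Code X → (X → Code Y) → Code Y
  return x >>= q = q x
  read k   >>= q = read λ c → k c >>= q

  -- A nondeterministic run: the blocks in `y` are chosen freely, each starting no lower than the
  -- bound of the one before.
  data Reads {x} {X : Set x} (y : Sub) (δ : C) : Code X → X → Set (ℓ ⊔ x) where
    done : ∀ {x} → Reads y δ (return x) x
    next : ∀ {k x b} (B : Block y δ b) → Reads y (bound B) (k (clue b)) x → Reads y δ (read k) x

  Reads->>= : ∀ {x x′} {X : Set x} {X′ : Set x′} {q : X → Code X′} {y δ p x x′} →
    Reads y δ p x → (∀ ε → Reads y ε (q x) x′) → Reads y δ (p >>= q) x′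
  Reads->>= done       s = s _
  Reads->>= (next B r) s = next B (Reads->>= r s)

  run : Code C → List (ℕ → C) → C
  run (return x) _       = x
  run (read k)   []      = proj₁ (inhabited whole)
  run (read k)   (b ∷ L) = run (k (clue b)) L

  ⋃ : List (ℕ → C) → Sub
  ⋃ L z = Any (λ b → ∃ λ n → z ≡ b n) L

  data Chain (δ : C) : List (ℕ → C) → Set ℓ where
    []  : Chain δ []
    _∷_ : ∀ {b L} (B : Block U δ b) → Chain (bound B) L → Chain δ (b ∷ L)

  Chain-above : ∀ {δ L z} → Chain δ L → ⋃ L z → δ ≤ z
  Chain-above (B ∷ _)  (here (n , refl)) = Block.all-above B n
  Chain-above (B ∷ Ls) (there z∈)        =
    ≤-trans (inj₁ (≤-<-trans (Block.above B) (Block.bounded B 0))) (Chain-above Ls z∈)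

  Chain-bounded : ∀ {δ L} → Chain δ L → Bounded lam (⋃ L)
  Chain-bounded {δ} []  = δ , λ ()
  Chain-bounded (B ∷ Ls) =
    let α , L≤α = Chain-bounded Ls
        γ , b≤γ , α≤γ = upper-bound (bound B) α
    in γ , λ { (here (n , refl)) → inj₁ (<-≤-trans (Block.bounded B n) b≤γ)
             ; (there z∈)        → ≤-trans (L≤α z∈) α≤γ }

  head≤ : ∀ {δ b L z} → Chain δ (b ∷ L) → ⋃ (b ∷ L) z → b 0 ≤ z
  head≤ (B ∷ _)  (here (n , refl)) = Increasing-≤ (Block.increasing B) ℕ.z≤n
  head≤ (B ∷ Ls) (there z∈) = inj₁ (<-≤-trans (Block.bounded B 0) (Chain-above Ls z∈))

  successor≤ : ∀ {δ b L z n} → Chain δ (b ∷ L) → ⋃ (b ∷ L) z → b n < z → b (suc n) ≤ z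
  successor≤ {n = n} (B ∷ _) (here (k , refl)) bn<z = Increasing-≤ (Block.increasing B)
    (ℕ.≰⇒> λ k≤n → <⇒≱ bn<z (Increasing-≤ (Block.increasing B) k≤n))
  successor≤ {n = n} (B ∷ Ls) (there z∈) _ =
    inj₁ (<-≤-trans (Block.bounded B (suc n)) (Chain-above Ls z∈))

  -- The first block consists of the least point of the union and its successive successors there,
  -- so the union determines it entry by entry.
  first-block : ∀ {δ δ′ b b′ L L′} → Chain δ (b ∷ L) → Chain δ′ (b′ ∷ L′) →
    ⋃ (b ∷ L) ≐ ⋃ (b′ ∷ L′) → b ≗ b′
  first-block Ls Ls′ (⊆′ , ⊇′) zero =
    ≤-antisym (head≤ Ls (⊇′ (here (0 , refl)))) (head≤ Ls′ (⊆′ (here (0 , refl))))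
  first-block {b = b} {b′} Ls@(B ∷ _) Ls′@(B′ ∷ _) eq@(⊆′ , ⊇′) (suc n) = ≤-antisym
    (successor≤ Ls (⊇′ (here (suc n , refl)))
      (subst (_< b′ (suc n)) (sym bn≡) (Block.increasing B′ n)))
    (successor≤ Ls′ (⊆′ (here (suc n , refl)))
      (subst (_< b (suc n)) bn≡ (Block.increasing B n)))
    where bn≡ = first-block Ls Ls′ eq n

  other-blocks : ∀ {δ δ′ b b′ L L′} → Chain δ (b ∷ L) → Chain δ′ (b′ ∷ L′) →
    b ≗ b′ → ⋃ (b ∷ L) ⊆ ⋃ (b′ ∷ L′) → ⋃ L ⊆ ⋃ L′
  other-blocks (B ∷ Ls) (B′ ∷ Ls′) b≗b′ ⊆′ z∈ with ⊆′ (there z∈)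
  ... | there z∈′ = z∈′
  ... | here (n , refl) = contradiction (Chain-above Ls z∈)
    (<⇒≱ (subst (_< bound B) (b≗b′ n) (Block.bounded B n)))

  -- This makes a code a colouring of sets: a union of blocks determines its blocks, hence every
  -- clue.
  run-unique : ∀ p {δ δ′ L L′} → Chain δ L → Chain δ′ L′ → ⋃ L ≐ ⋃ L′ → run p L ≡ run p L′
  run-unique (return x) _ _ _ = refl
  run-unique (read k) [] [] _ = refl
  run-unique (read k) [] (_ ∷ _) (_ , ⊇′) = contradiction (⊇′ (here (0 , refl))) λ ()
  run-unique (read k) (_ ∷ _) [] (⊆′ , _) = contradiction (⊆′ (here (0 , refl))) λ ()
  run-unique (read k) {L = b ∷ L} {b′ ∷ L′} Ls@(_ ∷ Ms) Ls′@(_ ∷ Ms′) eq@(⊆′ , ⊇′) = begin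
    run (k (clue b)) L    ≡⟨ run-unique (k (clue b)) Ms Ms′
                               (other-blocks Ls Ls′ b≗b′ ⊆′ , other-blocks Ls′ Ls (sym ∘ b≗b′) ⊇′) ⟩
    run (k (clue b)) L′   ≡⟨ cong (λ c → run (k c) L′) (clue-cong b≗b′) ⟩
    run (k (clue b′)) L′  ∎
    where
    open ≡-Reasoning
    b≗b′ = first-block Ls Ls′ eq

  Reads⇒run : ∀ {y δ p x} → Reads y δ p x → ∃ λ L → Chain δ L × ⋃ L ⊆ y × run p L ≡ x
  Reads⇒run done = [] , [] , (λ ()) , refl
  Reads⇒run (next {b = b} B r) with Reads⇒run r
  ... | L , Ls , L⊆y , eq = b ∷ L , forget B ∷ Ls ,
    (λ { (here (n , refl)) → Block.inside B n ; (there z∈) → L⊆y z∈ }) , eq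

  -- Later blocks lie above the bound of the first, so interleaving produces no repetition.
  Chain-enumeration : ∀ {δ b L} → Chain δ (b ∷ L) →
    ∃ λ (e : ℕ → C) → (∀ {m n} → e m ≡ e n → m ≡ n) × (∀ n → ⋃ (b ∷ L) (e n)) ×
                      (∀ {z} → ⋃ (b ∷ L) z → ∃ λ n → e n ≡ z)
  Chain-enumeration {b = b} (B ∷ []) =
    b , Increasing-injective (Block.increasing B) , (λ n → here (n , refl)) ,
    λ { (here (n , refl)) → n , refl }
  Chain-enumeration {b = b} {L} (B ∷ Ls@(_ ∷ _)) with Chain-enumeration Ls
  ... | e , injective , e∈ , onto =
    interleave b e ,
    interleave-injective b e (Increasing-injective (Block.increasing B)) injective b≢e , in⋃ , onto′
    where
    b≢e : ∀ m n → b m ≢ e n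
    b≢e m n eq = contradiction (Chain-above Ls (e∈ n))
      (<⇒≱ (subst (_< bound B) eq (Block.bounded B m)))

    in⋃ : ∀ n → ⋃ (b ∷ L) (interleave b e n)
    in⋃ n with interleave-∈ b e n
    ... | inj₁ hit      = here hit
    ... | inj₂ (k , eq) = there (subst (⋃ L) (sym eq) (e∈ k))

    onto′ : ∀ {z} → ⋃ (b ∷ L) z → ∃ λ n → interleave b e n ≡ z
    onto′ (here (k , refl)) = interleave-hitsˡ b e k
    onto′ (there z∈) with onto z∈
    ... | k , refl = interleave-hitsʳ b e k

  Chain-denumerable : ∀ {δ b L} → Chain δ (b ∷ L) → Denumerable lam (⋃ (b ∷ L))
  Chain-denumerable Ls = let e , injective , e∈ , onto = Chain-enumeration Ls in record
    { to        = λ n → e n , e∈ n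
    ; cong      = cong e
    ; bijective = injective , λ (z , z∈) → let n , eq = onto z∈ in n , λ { refl → eq }
    }

  module _ (p : Code C) where

    private
      -- Sets that are not the union of a chain satisfy this with any colour.
      Color : Setoid.Carrier ([-]^ℵ₀-bd lam) → C → Set ℓ
      Color (u , _) v = ∀ {δ L} → Chain δ L → ⋃ L ≐ u → run p L ≡ v

      total : ∀ u → ∃ (Color u)
      total (u , _) with em {P = ∃ λ δ → ∃ λ L → Chain δ L × ⋃ L ≐ u}
      ... | yes (_ , L , Ls , eq , eq⁻) =
        run p L , λ Ms (eq′ , eq′⁻) → run-unique p Ms Ls ((λ z → eq⁻ (eq′ z)) , λ z → eq′⁻ (eq z))
      ... | no ¬L = proj₁ (inhabited whole) , λ Ls eq → contradiction (_ , _ , Ls , eq) ¬L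

    abstract
      coloring-of : Σ (Coloring lam) λ c → ∀ u → Color u (Func.to c u)
      coloring-of = choice ([-]^ℵ₀-bd lam) C Color
        (λ (u⊆ , u⊇) color Ls (eq , eq⁻) → color Ls ((λ z → u⊇ (eq z)) , λ z → eq⁻ (u⊆ z)))
        total

    coloring : Coloring lam
    coloring = proj₁ coloring-of

    image-coloring : ∀ {x δ b L} → Chain δ (b ∷ L) → ⋃ (b ∷ L) ⊆ x →
      image lam coloring x (run p (b ∷ L))
    image-coloring {b = b} {L} Ls L⊆x =
      u , L⊆x , sym (proj₂ coloring-of u Ls ((λ z → z) , λ z → z))
      where u = ⋃ (b ∷ L) , Chain-denumerable Ls , Chain-bounded Ls

  -- Sets that a code reaches along every member of the filter

  Covers : ∀ {x s} {X : Set x} → Code X → Pred X s → Set (lsuc ℓ ⊔ f ⊔ x ⊔ s)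
  Covers p S = ∀ {y} → F y → ∀ δ {x} → S x → Reads y δ p x

  Coverable : ∀ {x s} {X : Set x} → Pred X s → Set (lsuc ℓ ⊔ f ⊔ x ⊔ s)
  Coverable S = ∃ λ p → Covers p S

  -- The extra `read`, whose clue is ignored, ensures at least one block, so that the coloured set
  -- is infinite even if `p` returns at once.
  Reads⇒image : ∀ {p x γ} → F x → (∀ δ → Reads x δ p γ) →
    image lam (coloring (read λ _ → p)) x γ
  Reads⇒image {p} {x} Fx reads =
    let o = proj₁ (inhabited whole)
        b , B , _ = block-above Fx o o
        L , Ls , L⊆x , eq = Reads⇒run (reads (bound B))
    in subst (image lam (coloring (read λ _ → p)) x) eq
      (image-coloring (read λ _ → p) (forget B ∷ Ls)
        λ { (here (n , refl)) → Block.inside B n ; (there z∈) → L⊆x z∈ })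

  ¬Coverable-whole : ¬ Coverable (U {A = C} {ℓ = ℓ})
  ¬Coverable-whole (p , covers) =
    let x , Fx , proper-image = magidor (coloring (read λ _ → p))
    in proper-image ((λ _ → tt) , λ {γ} _ → Reads⇒image Fx λ δ → covers Fx δ {γ} tt)

  done≡ : ∀ {x} {X : Set x} {y δ} {x x′ : X} → x ≡ x′ → Reads y δ (return x) x′
  done≡ refl = done

  Coverable-image : ∀ {x s t} {X : Set x} {S : Pred X s} {T : Pred C t} → Coverable S →
    (g : X → C) → (∀ {z} → T z → ∃ λ x → S x × g x ≡ z) → Coverable T
  Coverable-image (p , covers) g preimage = p >>= (return ∘ g) , λ Fy δ Tz →
    let x , Sx , eq = preimage Tz in Reads->>= (covers Fy δ Sx) λ _ → done≡ eq

  -- By uniformity `y` maps onto the whole cardinal, which would then be coverable too.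
  ¬Coverable-member : ∀ {y} → F y → ¬ Coverable y
  ¬Coverable-member {y} Fy cov = ¬Coverable-whole (Coverable-image cov g λ {z} _ →
    let (β , yβ) , eq = strictlySurjective z in β , yβ , trans (g≡ yβ) eq)
    where
    open Bijection (uniform Fy) using (to; strictlySurjective) renaming (cong to to-cong)

    g : C → C
    g β with em {P = y β}
    ... | yes yβ = to (β , yβ)
    ... | no  _  = β

    g≡ : ∀ {β} (yβ : y β) → g β ≡ to (β , yβ)
    g≡ {β} yβ with em {P = y β}
    ... | yes _  = to-cong refl
    ... | no ¬yβ = contradiction yβ ¬yβ

  abstract
    codeℕ : Code ℕ
    codeℕ = read λ (_ , _ , k) → read λ (_ , _ , l) → return (l ∸ k)

    -- Dropping entries of a block raises its position by any amount beyond some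
    -- threshold, so that the difference of two positions can be prescribed.
    Covers-ℕ : Covers codeℕ (U {A = ℕ} {ℓ = ℓ})
    Covers-ℕ Fy δ {n} _ =
      let b , B , _     = block-above Fy δ δ
          b′ , B′ , _   = block-above Fy (bound B) δ
          i , j , at    = pos-drop (Block.increasing B)
          i′ , j′ , at′ = pos-drop (Block.increasing B′)
      in next (Block-drop B (i + j′)) (next (Block-drop B′ (i′ + (j + n))) (done≡ (begin
        pos (λ m → b′ (i′ + (j + n) + m)) ∸ pos (λ m → b (i + j′ + m))
                                  ≡⟨ cong₂ _∸_ (at′ (j + n)) (at j′) ⟩
        j′ + (j + n) ∸ (j + j′)   ≡⟨ cong (_∸ (j + j′)) (ℕ.+-assoc j′ j n) ⟨
        j′ + j + n ∸ (j + j′)     ≡⟨ cong (λ k → k + n ∸ (j + j′)) (ℕ.+-comm j′ j) ⟩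
        j + j′ + n ∸ (j + j′)     ≡⟨ ℕ.m+n∸m≡n (j + j′) n ⟩
        n                         ∎)))
      where open ≡-Reasoning

  codeVec : ∀ {x} {X : Set x} → Code X → ℕ → Code (List X)
  codeVec p zero    = return []
  codeVec p (suc n) = p >>= λ x → codeVec p n >>= λ xs → return (x ∷ xs)

  Reads-codeVec : ∀ {x s} {X : Set x} {p : Code X} {S : Pred X s} → Covers p S →
    ∀ {y xs} → F y → All S xs → ∀ δ → Reads y δ (codeVec p (length xs)) xs
  Reads-codeVec covers Fy []         δ = done
  Reads-codeVec covers Fy (Sx ∷ Sxs) δ = Reads->>= (covers Fy δ Sx) λ ε →
    Reads->>= (Reads-codeVec covers Fy Sxs ε) λ _ → done

  Coverable-List : ∀ {x s} {X : Set x} {S : Pred X s} → Coverable S → Coverable (All S)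
  Coverable-List (p , covers) = codeℕ >>= codeVec p , λ Fy δ {xs} Sxs →
    Reads->>= (Covers-ℕ Fy δ {length xs} tt) (Reads-codeVec covers Fy Sxs)

  abstract
    Coverable-⋃ : ∀ {x s t u} {X : Set x} {S : Pred X s} {T : X → Pred C t} {V : Pred C u} →
      Coverable S → (∀ {x} → S x → Coverable (T x)) → (∀ {z} → V z → ∃ λ x → S x × T x z) →
      Coverable V
    Coverable-⋃ {X = X} {S} {T} (p , covers) covT V⊆ = p >>= (proj₁ ∘ q) , λ Fy δ Vz →
      let x , Sx , Tz = V⊆ Vz
      in Reads->>= (covers Fy δ Sx) λ ε → proj₂ (q x) Sx Fy ε Tz
      where
      -- Excluded middle fixes one membership proof per index, so that the second code depends on
      -- the index alone; an index outside `S` gets a dummy code.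
      q : ∀ x → ∃ λ p → S x → Covers p (T x)
      q x with em {P = S x}
      ... | yes Sx = proj₁ (covT Sx) , λ _ → proj₂ (covT Sx)
      ... | no ¬Sx = return (proj₁ (inhabited whole)) , λ Sx → contradiction Sx ¬Sx

  abstract
    -- If all segments were coverable, so would be the whole: a first block starting beyond the
    -- target names a segment that contains it, and the code of that segment finishes.
    smallest-uncoverable : ∃ λ κ → ¬ Coverable (_< κ) × (∀ {ξ} → ξ < κ → Coverable (_< ξ))
    smallest-uncoverable =
      let κ , ¬covκ , min = least (¬∀⇒∃¬ λ cov → ¬Coverable-whole (all⇒whole cov))
      in κ , ¬covκ , λ ξ<κ → dne λ ¬cov → <⇒≱ ξ<κ (min ¬cov)
      where
      all⇒whole : (∀ ξ → Coverable (_< ξ)) → Coverable (U {A = C} {ℓ = ℓ})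
      all⇒whole cov = read (λ (β , _) → proj₁ (cov β)) , λ Fy δ {γ} _ →
        let b , B , γ<b = block-above Fy δ γ in next B (proj₂ (cov (b 0)) Fy (bound B) γ<b)

  abstract
    -- Needed because blocks must be bounded. If some increasing ω-sequence is unbounded, the
    -- segments below its entries serve; otherwise a single chunk does.
    chunks : ∃ λ (K : ℕ → Sub) → (∀ β → ∃ λ m → K m β) ×
      (∀ m {b} → Increasing b → (∀ n → K m (b n)) → ∃ λ γ → ∀ n → b n < γ)
    chunks with em {P = ∃ λ b → Increasing b × ¬ (∃ λ γ → ∀ n → b n < γ)}
    ... | yes (b , inc , unbounded) =
      (λ m → _< b m) ,
      (λ β → dne λ ¬∃ → unbounded (β , λ n → <-≤-trans (inc n) (≮⇒≥ λ β<b → ¬∃ (suc n , β<b)))) ,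
      λ m _ K∋b → b m , K∋b
    ... | no ¬unbounded =
      (λ _ → U) , (λ _ → 0 , tt) , λ _ {b} inc _ → dne λ unbounded → ¬unbounded (b , inc , unbounded)

  -- The least ordinal onto which no colouring maps all members of F

  module Threshold
    (κ : C) (¬Coverable-κ : ¬ Coverable (_< κ)) (Coverable-below : ∀ {ξ} → ξ < κ → Coverable (_< ξ))
    (K : ℕ → Sub) (K-cover : ∀ β → ∃ λ m → K m β)
    (K-bounded : ∀ m {b} → Increasing b → (∀ n → K m (b n)) → ∃ λ γ → ∀ n → b n < γ)
    where

    abstract
      κ-nonempty : ∃ (_< κ)
      κ-nonempty = dne λ ¬∃ →
        ¬Coverable-κ (return κ , λ _ _ z<κ → contradiction (_ , z<κ) ¬∃)

    -- Otherwise the ordinals below `κ` would be those below `ξ` and `ξ` itself, a union of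
    -- coverable sets.
    κ-limit : ∀ {ξ} → ξ < κ → ∃ λ η → η < κ × ξ < η
    κ-limit {ξ} ξ<κ = dne λ ¬∃ → ¬Coverable-κ (Coverable-⋃ {T = T} (codeℕ , Covers-ℕ)
      (λ {n} _ → coverable n) λ {z} z<κ → split (≮⇒≥ λ ξ<z → ¬∃ (z , z<κ , ξ<z)))
      where
      T : ℕ → Sub
      T zero    z = z < ξ
      T (suc _) z = ξ ≡ z

      coverable : ∀ n → Coverable (T n)
      coverable zero    = Coverable-below ξ<κ
      coverable (suc _) = return ξ , λ _ _ → done≡

      split : ∀ {z} → z ≤ ξ → ∃ λ n → U {ℓ = ℓ} n × T n z
      split (inj₁ z<ξ) = 0 , tt , z<ξ
      split (inj₂ z≡ξ) = 1 , tt , sym z≡ξ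

    -- By `Fat⇒¬Coverable` and `¬Fat⇒Coverable` this amounts to not being coverable, but it supplies
    -- a map that a code can apply.
    Fat : Sub → Set ℓ
    Fat S = ∃ λ (π : C → C) → ∀ {z} → z < κ → ∃ λ s → S s × π s ≡ z

    Fat-⊆ : ∀ {S T} → S ⊆ T → Fat S → Fat T
    Fat-⊆ S⊆T (π , onto) = π , λ z<κ → let s , Ss , eq = onto z<κ in s , S⊆T Ss , eq

    Fat⇒inhabited : ∀ {S} → Fat S → ∃ S
    Fat⇒inhabited (_ , onto) = let s , Ss , _ = onto (proj₂ κ-nonempty) in s , Ss

    Fat⇒¬Coverable : ∀ {S} → Fat S → ¬ Coverable S
    Fat⇒¬Coverable (π , onto) cov = ¬Coverable-κ (Coverable-image cov π onto)

    -- Enumerate S by recursion along κ without repetition: either the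
    -- enumeration reaches κ, or it exhausts S at some stage before.
    ¬Fat⇒Coverable : ∀ {S} → ¬ Fat S → Coverable S
    ¬Fat⇒Coverable {S} ¬fat =
      let g , spec = recursive-choice Q Q-resp total
          ξ , stuck = ¬∀⇒∃¬ {P = λ ξ → ξ < κ → Fresh ξ (λ η _ → g η) (g ξ)} (¬fat ∘ fat g)
          ξ<κ = dne λ ξ≮κ → stuck λ ξ<κ → contradiction ξ<κ ξ≮κ
          exhausted = [ (λ fresh → contradiction (λ _ → fresh) stuck) , id ]′ (spec ξ)
      in Coverable-image (Coverable-below ξ<κ) g λ {s} Ss → dne λ ¬∃ →
        exhausted (s , Ss , λ η η<ξ eq → ¬∃ (η , η<ξ , eq))
      where
      Fresh Q : ∀ ξ → (∀ η → η < ξ → C) → C → Set ℓ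
      Fresh ξ h s = S s × (∀ η η<ξ → h η η<ξ ≢ s)
      Q ξ h s = Fresh ξ h s ⊎ ¬ ∃ (Fresh ξ h)

      Fresh-resp : ∀ {ξ h h′ s} → (∀ η η<ξ → h η η<ξ ≡ h′ η η<ξ) → Fresh ξ h s → Fresh ξ h′ s
      Fresh-resp eq (Ss , new) = Ss , λ η η<ξ eq′ → new η η<ξ (trans (eq η η<ξ) eq′)

      Q-resp : ∀ {ξ h h′ s} → (∀ η η<ξ → h η η<ξ ≡ h′ η η<ξ) → Q ξ h s → Q ξ h′ s
      Q-resp eq = Sum.map (Fresh-resp eq)
        λ ¬∃ (s , fresh) → ¬∃ (s , Fresh-resp (λ η η<ξ → sym (eq η η<ξ)) fresh)

      total : ∀ ξ h → ∃ (Q ξ h)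
      total ξ h with em {P = ∃ (Fresh ξ h)}
      ... | yes (s , fresh) = s , inj₁ fresh
      ... | no ¬∃           = ξ , inj₂ ¬∃

      fat : ∀ g → (∀ ξ → ξ < κ → Fresh ξ (λ η _ → g η) (g ξ)) → Fat S
      fat g fresh = proj₁ ∘ inverse , λ {z} z<κ →
        g z , proj₁ (fresh z z<κ) , proj₂ (inverse (g z)) z<κ refl
        where
        g-injective : ∀ {y z} → y < κ → z < κ → g y ≡ g z → y ≡ z
        g-injective {y} {z} y<κ z<κ eq with compare y z
        ... | tri< y<z _ _ = contradiction eq (proj₂ (fresh z z<κ) y y<z)
        ... | tri≈ _ y≡z _ = y≡z
        ... | tri> _ _ z<y = contradiction (sym eq) (proj₂ (fresh y y<κ) z z<y)

        inverse : ∀ s → ∃ λ z → ∀ {z′} → z′ < κ → g z′ ≡ s → z ≡ z′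
        inverse s with em {P = ∃ λ z → z < κ × g z ≡ s}
        ... | yes (z , z<κ , eq) = z , λ z′<κ eq′ → g-injective z<κ z′<κ (trans eq (sym eq′))
        ... | no ¬∃              = s , λ z′<κ eq′ → contradiction (_ , z′<κ , eq′) ¬∃

    abstract
      -- A pigeonhole principle: if no piece were fat, all pieces would be coverable, and so would
      -- `V`.
      Fat-piece : ∀ {x s} {X : Set x} {S : Pred X s} {T : X → Sub} {V : Sub} →
        Coverable S → ¬ Coverable V → (∀ {z} → V z → ∃ λ x → S x × T x z) →
        ∃ λ x → S x × Fat (T x)
      Fat-piece cov ¬cov V⊆ = dne λ ¬∃ → ¬cov (Coverable-⋃ cov
        (λ {x} Sx → ¬Fat⇒Coverable λ fat → ¬∃ (x , Sx , fat)) V⊆)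

    -- A sequence of members of the filter with escaping points

    Meet : (C → Sub) → List C → ℕ → Sub
    Meet y s m β = K m β × All (λ η → y η β) s

    Escapes : Sub → Sub → Set ℓ
    Escapes T Y = ∃ λ a → T a × ¬ Y a × (∀ {b δ} → Block Y δ b → before b ≢ a)

    module _ {ξ} (ξ<κ : ξ < κ) (T : List C → ℕ → Sub) where

      private
        collapse : ∀ s m → ∃ λ (π : C → C) → Fat (T s m) → ∀ {z} → z < κ → ∃ λ a → T s m a × π a ≡ z
        collapse s m with em {P = Fat (T s m)}
        ... | yes (π , onto) = π , λ _ → onto
        ... | no ¬fat        = id , λ fat → contradiction fat ¬fat

        select : Clue → ℕ → C
        select (β , _ , _) zero    = β
        select (_ , γ , _) (suc _) = γ

        lists : Coverable (All (_< ξ))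
        lists = Coverable-List (Coverable-below ξ<κ)

        code : Code C
        code = read λ c → proj₁ lists >>= λ s → codeℕ >>= λ m → codeℕ >>= λ j →
          return (proj₁ (collapse s m) (select c j))

        reads : ∀ {y δ b} → F y → Block y δ b → ∀ {s} → All (_< ξ) s → ∀ m j →
          Reads y δ code (proj₁ (collapse s m) (select (clue b) j))
        reads Fy B s<ξ m j = next B (Reads->>= (proj₂ lists Fy (bound B) s<ξ) λ ε →
          Reads->>= (Covers-ℕ Fy ε {m} tt) λ ε →
          Reads->>= (Covers-ℕ Fy ε {j} tt) λ _ → done)

      -- The code reads a block, then `s`, `m` and a choice between the first entry and the value of
      -- `before`, and collapses the chosen point by a map of `T s m` onto `κ`. If it omits `z < κ`
      -- on `y` above `δ`, a preimage of `z` in any fat `T s m` is neither in the tail of `y` nor a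
      -- value of `before` there. One `z` serves all `s` and `m`.
      escape : ∃ λ Y → F Y × (∀ {s m} → All (_< ξ) s → Fat (T s m) → Escapes (T s m) Y)
      escape =
        let y , Fy , δ , z , z<κ , unread = omitted
        in tail y δ , F-tail Fy δ , λ {s} {m} s<ξ fat →
          let a , Ta , eq = proj₂ (collapse s m) fat z<κ in a , Ta ,
          (λ (ya , δ≤a) → let b , B , b0≡a = block-from Fy ya δ≤a in
            unread (subst (Reads y δ code) (trans (cong (proj₁ (collapse s m)) b0≡a) eq)
              (reads Fy B s<ξ m 0))) ,
          λ B before≡a →
            unread (subst (Reads y δ code) (trans (cong (proj₁ (collapse s m)) before≡a) eq)
              (reads Fy (widen B) s<ξ m 1))
        where
        omitted : ∃ λ y → F y × (∃ λ δ → ∃ λ z → z < κ × ¬ Reads y δ code z)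
        omitted = dne λ ¬∃ → ¬Coverable-κ (code , λ {y} Fy δ {z} z<κ →
          dne λ unread → ¬∃ (y , Fy , δ , z , z<κ , unread))

        widen : ∀ {y δ ε b} → Block (tail y δ) ε b → Block y δ b
        widen B = record
          { inside     = proj₁ ∘ Block.inside B
          ; above      = proj₂ (Block.inside B 0)
          ; increasing = Block.increasing B
          ; bound      = bound B
          ; bounded    = Block.bounded B
          }

    escaping-sequence : ∃ λ (y : C → Sub) → (∀ ξ → F (y ξ)) ×
      (∀ {ξ} → ξ < κ → ∀ {s m} → All (_< ξ) s → Fat (Meet y s m) → Escapes (Meet y s m) (y ξ))
    escaping-sequence =
      let y , spec = recursive-choice Q
            (λ h≡h′ (FY , esc) → FY , λ ξ<κ s<ξ fat →
              Escapes-⊆ (T-resp h≡h′)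
                (esc ξ<κ s<ξ (Fat-⊆ (T-resp (λ η η<ξ → sym (h≡h′ η η<ξ))) fat)))
            total
      in y , (λ ξ → proj₁ (spec ξ)) , λ {ξ} ξ<κ s<ξ fat →
        Escapes-⊆ (λ (Kβ , yβ) → Kβ , All.zipWith (λ (η<ξ , yη) → yη η<ξ) (s<ξ , yβ))
          (proj₂ (spec ξ) ξ<κ s<ξ (Fat-⊆ (λ (Kβ , yβ) → Kβ , All.map const yβ) fat))
      where
      -- `Meet` for a sequence given only below `ξ`; the two agree on lists of ordinals below `ξ`.
      T : ∀ ξ → (∀ η → η < ξ → Sub) → List C → ℕ → Sub
      T ξ h s m β = K m β × All (λ η → (η<ξ : η < ξ) → h η η<ξ β) s

      T-resp : ∀ {ξ h h′ s m} → (∀ η η<ξ → h η η<ξ ≡ h′ η η<ξ) → T ξ h s m ⊆ T ξ h′ s m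
      T-resp h≡h′ {β} (Kβ , hβ) = Kβ ,
        All.map (λ {η} hη η<ξ → subst (λ Y → Y β) (h≡h′ η η<ξ) (hη η<ξ)) hβ

      Escapes-⊆ : ∀ {S S′ Y} → S ⊆ S′ → Escapes S Y → Escapes S′ Y
      Escapes-⊆ S⊆S′ (a , Sa , rest) = a , S⊆S′ Sa , rest

      Q : ∀ ξ → (∀ η → η < ξ → Sub) → Sub → Set (ℓ ⊔ f)
      Q ξ h Y = F Y × (ξ < κ → ∀ {s m} → All (_< ξ) s → Fat (T ξ h s m) → Escapes (T ξ h s m) Y)

      total : ∀ ξ h → ∃ (Q ξ h)
      total ξ h with em {P = ξ < κ}
      ... | yes ξ<κ = let Y , FY , esc = escape ξ<κ (T ξ h) in Y , FY , λ _ → esc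
      ... | no ξ≮κ  = U , whole , λ ξ<κ → contradiction ξ<κ ξ≮κ

    -- The indices of the sets that contain a point

    Trace : (C → Sub) → C → (ℕ → C) → Set ℓ
    Trace y β χ = Increasing χ × (∀ n → y (χ n) β)

    module _ (y : C → Sub) (Fy : ∀ ξ → F (y ξ)) where

      -- If the indices below `κ` of sets containing `β` are unbounded in `κ`, pick them one above
      -- the other; otherwise repeat a strict bound. Either way the result is a sequence below `κ`,
      -- so one argument bounds both kinds.
      trace : ∀ β → ∃ λ χ → (∀ n → χ n < κ) × (Trace y β χ ⊎ (∀ {ξ} → ξ < κ → y ξ β → ξ < χ 0))
      trace β with em {P = ∀ φ → φ < κ → ∃ λ ξ → ξ < κ × φ ≤ ξ × y ξ β}
      ... | no bounded =
        let φ , ¬φ = ¬∀⇒∃¬ bounded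
            φ<κ = dne λ φ≮κ → ¬φ λ φ<κ → contradiction φ<κ φ≮κ
        in const φ , const φ<κ , inj₂ λ {ξ} ξ<κ yβ → dne λ ξ≮φ →
          ¬φ λ _ → ξ , ξ<κ , ≮⇒≥ ξ≮φ , yβ
      ... | yes unbounded =
        proj₁ ∘ χ , (λ n → proj₁ (proj₂ (χ n))) ,
        inj₁ ((λ n → proj₁ (proj₂ (beyond (χ n)))) , λ n → proj₂ (proj₂ (χ n)))
        where
        Index : Set ℓ
        Index = ∃ λ ξ → ξ < κ × y ξ β

        beyond : (i : Index) → ∃ λ ξ → proj₁ i < ξ × ξ < κ × y ξ β
        beyond (ξ , ξ<κ , _) =
          let φ , φ<κ , ξ<φ      = κ-limit ξ<κ
              η , η<κ , φ≤η , yη = unbounded φ φ<κ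
          in η , <-≤-trans ξ<φ φ≤η , η<κ , yη

        χ : ℕ → Index
        χ zero    = let φ , φ<κ = κ-nonempty ; ξ , ξ<κ , _ , yξ = unbounded φ φ<κ in ξ , ξ<κ , yξ
        χ (suc n) = let ξ , _ , ξ<κ , yξ = beyond (χ n) in ξ , ξ<κ , yξ

      -- The code reads a point `β`, a number `n` and an ordinal below `χ β n`. An `ε < κ` that it
      -- omits on `x` above `δ` bounds the traces on that tail. Intersecting with `y ε` excludes the
      -- second alternative of `trace`, which would give `ε < χ β 0`.
      bounded-traces : ∃ λ (χ : C → ℕ → C) → (∀ β n → χ β n < κ) × ∃ λ x → F x × ∃ λ ε → ε < κ ×
        (∀ {β} → x β → Trace y β (χ β) × (∀ n → χ β n ≤ ε))
      bounded-traces =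
        let x , Fx , δ , ε , ε<κ , unread = omitted
            χ≤ε : ∀ {β} → x β → δ ≤ β → ∀ n → χ β n ≤ ε
            χ≤ε xβ δ≤β n = ≮⇒≥ λ ε<χ → unread (reads Fx xβ δ≤β n ε<χ)
        in χ , χ<κ , tail x δ ∩ y ε , intersection (F-tail Fx δ) (Fy ε) , ε , ε<κ ,
          λ {β} ((xβ , δ≤β) , yεβ) →
            [ id , (λ y<χ → contradiction (χ≤ε xβ δ≤β 0) (<⇒≱ (y<χ ε<κ yεβ))) ]′
              (proj₂ (proj₂ (trace β)))
            , χ≤ε xβ δ≤β
        where
        χ : C → ℕ → C
        χ = proj₁ ∘ trace

        χ<κ : ∀ β n → χ β n < κ
        χ<κ = proj₁ ∘ proj₂ ∘ trace

        below : C → Code C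
        below β = codeℕ >>= λ n → proj₁ (Coverable-below (χ<κ β n))

        code : Code C
        code = read λ (β , _) → below β

        reads : ∀ {x β δ ε} → F x → x β → δ ≤ β → ∀ n → ε < χ β n → Reads x δ code ε
        reads {x} {β} {δ} {ε} Fx xβ δ≤β n ε<χ =
          let b , B , b0≡β = block-from Fx xβ δ≤β
          in next B (subst (λ β → Reads x (bound B) (below β) ε) (sym b0≡β)
            (Reads->>= (Covers-ℕ Fx (bound B) {n} tt) λ γ →
              proj₂ (Coverable-below (χ<κ β n)) Fx γ ε<χ))

        omitted : ∃ λ x → F x × (∃ λ δ → ∃ λ ε → ε < κ × ¬ Reads x δ code ε)
        omitted = dne λ ¬∃ → ¬Coverable-κ (code , λ {x} Fx δ {ε} ε<κ →
          dne λ unread → ¬∃ (x , Fx , δ , ε , ε<κ , unread))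

    -- Fixing the traces on fat sets, and the contradiction

    FatSubset : Sub → Set (lsuc ℓ)
    FatSubset w = ∃ λ (w′ : Sub) → w′ ⊆ w × Fat w′

    abstract
      chunk-fat : ∀ {x} → F x → ∃ λ m → Fat (x ∩ K m)
      chunk-fat {x} Fx =
        let m , _ , fat = Fat-piece {T = λ m → x ∩ K m} (codeℕ , Covers-ℕ) (¬Coverable-member Fx)
              λ {β} xβ → let m , Kβ = K-cover β in m , tt , xβ , Kβ
        in m , fat

      -- The values of `φ` lie below some `ε′ < κ`, a coverable set of indices, so some fibre is
      -- fat.
      refine : ∀ {w : Sub} {φ : C → C} {ε} → Fat w → ε < κ → (∀ {β} → w β → φ β ≤ ε) →
        ∃ λ ξ → Fat (λ β → w β × φ β ≡ ξ)
      refine {w} {φ} fat ε<κ φ≤ε =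
        let ε′ , ε′<κ , ε<ε′ = κ-limit ε<κ
            ξ , _ , fat′ = Fat-piece {T = λ ξ β → w β × φ β ≡ ξ} (Coverable-below ε′<κ)
              (Fat⇒¬Coverable fat) λ {β} wβ → φ β , ≤-<-trans (φ≤ε wβ) ε<ε′ , wβ , refl
        in ξ , fat′

    constant-traces : ∀ (χ : C → ℕ → C) {w : Sub} {ε} → Fat w → ε < κ →
      (∀ {β} → w β → ∀ n → χ β n ≤ ε) →
      ∃ λ (ξ : ℕ → C) → ∀ n → Fat (λ β → w β × (∀ i → i ℕ.< n → χ β i ≡ ξ i))
    constant-traces χ {w} {ε} fat ε<κ χ≤ε = ξ , λ n →
      Fat-⊆ (λ Wβ → proj₁ (proj₂ (W n)) Wβ , W-const n Wβ) (proj₂ (proj₂ (W n)))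
      where
      step : ∀ n (p : FatSubset w) → ∃ λ ξ → Fat (λ β → proj₁ p β × χ β n ≡ ξ)
      step n (_ , w′⊆w , fat′) = refine fat′ ε<κ λ w′β → χ≤ε (w′⊆w w′β) n

      W : ℕ → FatSubset w
      W zero    = w , id , fat
      W (suc n) = (λ β → proj₁ (W n) β × χ β n ≡ proj₁ (step n (W n))) ,
        (λ (Wβ , _) → proj₁ (proj₂ (W n)) Wβ) , proj₂ (step n (W n))

      ξ : ℕ → C
      ξ n = proj₁ (step n (W n))

      W-const : ∀ n {β} → proj₁ (W n) β → ∀ i → i ℕ.< n → χ β i ≡ ξ i
      W-const (suc n) (Wβ , eq) i i<1+n with ℕ.m≤n⇒m<n∨m≡n (ℕ.s≤s⁻¹ i<1+n)
      ... | inj₁ i<n  = W-const n Wβ i i<n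
      ... | inj₂ refl = eq

    -- For `i < n` the points `a i` and `a n` differ, since only the latter is in `Y i`. Take an
    -- increasing subsequence, bounded because it stays in `K m`. Its entries after `a (ν n)` form a
    -- block in `Y (ν n)`, and for a suitable `n` the value of `before` there is `a (ν n)`.
    Galvin–Prikry : ∀ m (Y : ℕ → Sub) (a : ℕ → C) → (∀ n → K m (a n)) →
      (∀ {i n} → i ℕ.< n → Y i (a n)) → (∀ n → ¬ Y n (a n)) →
      ¬ (∀ n {b δ} → Block (Y n) δ b → before b ≢ a n)
    Galvin–Prikry m Y a Ka Ya ¬Ya avoid =
      let ν , ν-mono , inc = increasing-subsequence a
            λ {i} {n} i<n eq → ¬Ya i (subst (Y i) (sym eq) (Ya i<n))
          γ , bounded = K-bounded m inc (Ka ∘ ν)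
          n , eq = before-drop inc
      in avoid (ν n) {δ = a (ν (suc n + 0))} (record
        { inside     = λ k → Ya (ν-mono (ℕ.s≤s (ℕ.m≤m+n n k)))
        ; above      = inj₂ refl
        ; increasing = Increasing-drop inc (suc n)
        ; bound      = γ
        ; bounded    = λ k → bounded (suc n + k)
        }) eq

    module _ (y : C → Sub)
      (escapes : ∀ {ξ} → ξ < κ → ∀ {s m} → All (_< ξ) s → Fat (Meet y s m) →
                 Escapes (Meet y s m) (y ξ))
      (χ : C → ℕ → C) (χ<κ : ∀ β n → χ β n < κ) {x : Sub} (traces : ∀ {β} → x β → Trace y β (χ β))
      (m : ℕ) (ξ : ℕ → C)
      (fat : ∀ n → Fat (λ β → (x β × K m β) × (∀ i → i ℕ.< n → χ β i ≡ ξ i)))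
      where

      private
        member : ∀ n → ∃ λ β → (x β × K m β) × (∀ i → i ℕ.< n → χ β i ≡ ξ i)
        member = Fat⇒inhabited ∘ fat

        ξ<κ : ∀ n → ξ n < κ
        ξ<κ n = let β , _ , eq = member (suc n) in subst (_< κ) (eq _ ℕ.≤-refl) (χ<κ β n)

        ξ-increasing : Increasing ξ
        ξ-increasing n = let β , (xβ , _) , eq = member (suc (suc n)) in
          subst₂ _<_ (eq _ (ℕ.n≤1+n _)) (eq _ ℕ.≤-refl) (proj₁ (traces xβ) n)

        -- Points whose traces agree with `ξ` below `n` lie in every `y (ξ i)` with `i < n`, so the
        -- meet contains a fat set.
        escaped : ∀ n → Escapes (Meet y (applyUpTo ξ n) m) (y (ξ n))
        escaped n = escapes (ξ<κ n) (applyUpTo⁺₁ ξ n (Increasing-< ξ-increasing))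
          (Fat-⊆ (λ {β} ((xβ , Kβ) , eq) → Kβ , applyUpTo⁺₁ ξ n λ i<n →
            subst (λ η → y η β) (eq _ i<n) (proj₂ (traces xβ) _)) (fat n))

      ¬constant-traces : ⊥
      ¬constant-traces = Galvin–Prikry m (y ∘ ξ) (proj₁ ∘ escaped)
        (λ n → proj₁ (proj₁ (proj₂ (escaped n))))
        (λ {i} {n} i<n → applyUpTo⁻ ξ n (proj₂ (proj₁ (proj₂ (escaped n)))) i<n)
        (λ n → proj₁ (proj₂ (proj₂ (escaped n))))
        λ n → proj₂ (proj₂ (proj₂ (escaped n)))

    absurd : ⊥
    absurd =
      case escaping-sequence of λ (y , Fy , escapes) →
      case bounded-traces y Fy of λ (χ , χ<κ , x , Fx , ε , ε<κ , traces) →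
      case chunk-fat Fx of λ (m , fat) →
      case constant-traces χ fat ε<κ (proj₂ ∘ traces ∘ proj₁) of λ (ξ , fats) →
      ¬constant-traces y escapes χ χ<κ (proj₁ ∘ traces) m ξ fats

  no-Magidor-filter : ⊥
  no-Magidor-filter =
    case smallest-uncoverable of λ (κ , ¬covκ , cov<) →
    case chunks of λ (K , K-cover , K-bounded) →
    Threshold.absurd κ ¬covκ cov< K K-cover K-bounded

theorem3p4 : (∀ {p} → ExcludedMiddle p) →
    (∀ {a e b r} → Choice a e b r) →
    ∀ {ℓ f} (lam : Cardinal ℓ) → Uncountable lam →
    ¬ (∃ λ (F : Pred (Subset lam) f) → IsMagidorFilter lam F)
theorem3p4 em choice lam uncountable (F , isMagidor) =
  MagidorFilter.no-Magidor-filter em choice lam uncountable F isMagidor
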